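{- Let $\Phi$ be a finite nonempty set of proposition symbols and let $\mathcal{K} \subseteq \mathcal{KT}(\Phi)$ be a class of $\Phi$-models with teams. Then $\mathcal{K}$ is definable in $\mathrm{ML}(\triangledown)(\Phi)$ if and only if $\mathcal{K}$ is closed under unions, is closed under team $k$-bisimulation for some $k \in \mathbb{N}$, and has the empty team property.
   Context: Kripke models and teams. A Kripke model over a set $\Phi$ of proposition symbols is a triple $K=(W,R,V)$ with $W$ a set, $R\subseteq W\times W$, and $V:\Phi\to\mathcal{P}(W)$. A team of $K$ is any subset $T\subseteq W$. Write $R[T]=\{v\in W\mid \exists w\in T: wRv\}$, and $T[R]S$ if for every $v\in S$ there is $w\in T$ with $wRv$ and for every $w\in T$ there is $v\in S$ with $wRv$. A $\Phi$-model with a team is a pair $(K,T)$ with $K$ a Kripke model over $\Phi$ and $T$ a team of $K$; $\mathcal{KT}(\Phi)$ is the class of all such pairs. Modal logic with nonemptiness operator $\mathrm{ML}(\triangledown)(\Phi)$: formulas are generated by $\varphi:= p\mid \neg p\mid(\varphi\land\varphi)\mid(\varphi\lor\varphi)\mid\Diamond\varphi\mid\Box\varphi\mid\triangledown\varphi$, $p\in\Phi$. Team semantics: $K,T\models p$ iff $T\subseteq V(p)$; $K,T\models\neg p$ iff $T\cap V(p)=\emptyset$; $K,T\models\varphi\land\psi$ iff $K,T\models\varphi$ and $K,T\models\psi$; $K,T\models\varphi\lor\psi$ iff there are $T_1,T_2$ with $T_1\cup T_2=T$, $K,T_1\models\varphi$ and $K,T_2\models\psi$; $K,T\models\Diamond\varphi$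 iff $K,S\models\varphi$ for some $S$ with $T[R]S$; $K,T\models\Box\varphi$ iff $K,R[T]\models\varphi$; $K,T\models\triangledown\varphi$ iff $T=\emptyset$ or there is $S\subseteq T$ with $S\neq\emptyset$ and $K,S\models\varphi$. For a state $w$, $K,w\models\varphi$ abbreviates $K,\{w\}\models\varphi$. Bisimulation. $K,w\rightleftarrows_0 K',w'$ iff $K,w\models p\iff K',w'\models p$ for all $p\in\Phi$. $K,w\rightleftarrows_{k+1}K',w'$ iff $K,w\rightleftarrows_0K',w'$, for every $v$ with $wRv$ there is $v'$ with $w'R'v'$ and $K,v\rightleftarrows_kK',v'$, and for every $v'$ with $w'R'v'$ there is $v$ with $wRv$ and $K,v\rightleftarrows_kK',v'$. Pairs $(K,T)$ and $(K',T')$ are team $k$-bisimilar, $K,T[\rightleftarrows_k]K',T'$, if for every $w\in T$ there is $w'\in T'$ with $K,w\rightleftarrows_kK',w'$ and for every $w'\in T'$ there is $w\in T$ with $K,w\rightleftarrows_kK',w'$. Closure properties of a class $\mathcal{K}\subseteq\mathcal{KT}(\Phi)$. It is closed under team $k$-bisimulation if $(K,T)\in\mathcal{K}$ and $K,T[\rightleftarrows_k]K',T'$ imply $(K',T')\in\mathcal{K}$. It is closed under unions if, whenever $T_i$, $i\in I$, are teams of a Kripke model $K$ with $(K,T_i)\in\mathcal{K}$ for all $i\in I$, then $(K,\bigcup_{i\in I}T_i)\in\mathcal{K}$. It has the empty team property if $(K,\emptyset)\in\mathcal{K}$ for every Kripke model $K$ over $\Phi$. $\mathcal{K}$ is definable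 in a logic if there is a formula $\varphi$ of that logic with $\mathcal{K}=\{(K,T)\in\mathcal{KT}(\Phi)\mid K,T\models\varphi\}$. -}

module Defs where

open import Data.Fin.Base using (Fin)
open import Data.Nat.Base using (ℕ; zero; suc)
open import Data.Product.Base using (Σ; ∃; ∃-syntax; _×_; _,_)
open import Data.Sum.Base using (_⊎_)
open import Function.Bundles using (_⇔_; _↔_)
open import Level using (Level; 0ℓ; Lift) renaming (suc to lsuc)
open import Relation.Binary.Core using (Rel)
open import Relation.Unary using
  (Pred; _∈_; _⊆_; _≐_; _∪_; _∩_; ∅; ｛_｝; Empty; Satisfiable; ⋃)

Finite : Set → Set
Finite A = ∃[ n ] (A ↔ Fin n)

record KripkeModel (Φ : Set) : Set₁ where
  field
    W : Set
    R : Rel W 0ℓ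
    V : Φ → Pred W 0ℓ

open KripkeModel public

Team : {Φ : Set} → KripkeModel Φ → Set₁
Team K = Pred (W K) 0ℓ

KT : Set → Set₁
KT Φ = Σ (KripkeModel Φ) Team

_⟦_⟧ : {Φ : Set} (K : KripkeModel Φ) → Team K → Team K
(K ⟦ T ⟧) v = ∃[ w ] (w ∈ T × R K w v)

-- Successor K T S is the relation T[R]S.
Successor : {Φ : Set} (K : KripkeModel Φ) → Team K → Team K → Set
Successor K T S =
    (∀ v → v ∈ S → ∃[ w ] (w ∈ T × R K w v))
  × (∀ w → w ∈ T → ∃[ v ] (v ∈ S × R K w v))

infixr 7 _∧′_
infixr 6 _∨′_
infix  8 ◇_ □_ ▽_

data ML▽ (Φ : Set) : Set where
  var  : Φ → ML▽ Φ
  ¬var : Φ → ML▽ Φ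
  _∧′_ : ML▽ Φ → ML▽ Φ → ML▽ Φ
  _∨′_ : ML▽ Φ → ML▽ Φ → ML▽ Φ
  ◇_   : ML▽ Φ → ML▽ Φ
  □_   : ML▽ Φ → ML▽ Φ
  ▽_   : ML▽ Φ → ML▽ Φ

infix 3 _⊨_ _⇄₀_ _⇄⟨_⟩_ _[⇄⟨_⟩]_

-- Teams are predicates without extensional equality, so T₁ ∪ T₂ = T is
-- expressed by mutual inclusion.
_⊨_ : {Φ : Set} → KT Φ → ML▽ Φ → Set₁
(K , T) ⊨ var p    = Lift (lsuc 0ℓ) (T ⊆ V K p)
(K , T) ⊨ ¬var p   = Lift (lsuc 0ℓ) (Empty (T ∩ V K p))
(K , T) ⊨ (φ ∧′ ψ) = ((K , T) ⊨ φ) × ((K , T) ⊨ ψ)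
(K , T) ⊨ (φ ∨′ ψ) = Σ (Team K) λ T₁ → Σ (Team K) λ T₂ →
  (T₁ ∪ T₂ ≐ T) × ((K , T₁) ⊨ φ) × ((K , T₂) ⊨ ψ)
(K , T) ⊨ (◇ φ)    = Σ (Team K) λ S → Successor K T S × ((K , S) ⊨ φ)
(K , T) ⊨ (□ φ)    = (K , K ⟦ T ⟧) ⊨ φ
(K , T) ⊨ (▽ φ)    = Empty T ⊎
  Σ (Team K) λ S → (S ⊆ T) × Satisfiable S × ((K , S) ⊨ φ)

PointedModel : Set → Set₁
PointedModel Φ = Σ (KripkeModel Φ) W

_⇄₀_ : {Φ : Set} → PointedModel Φ → PointedModel Φ → Set₁
(K , w) ⇄₀ (K′ , w′) =
  ∀ p → ((K , ｛ w ｝) ⊨ var p) ⇔ ((K′ , ｛ w′ ｝) ⊨ var p)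

_⇄⟨_⟩_ : {Φ : Set} → PointedModel Φ → ℕ → PointedModel Φ → Set₁
(K , w) ⇄⟨ zero  ⟩ (K′ , w′) = (K , w) ⇄₀ (K′ , w′)
(K , w) ⇄⟨ suc k ⟩ (K′ , w′) =
    ((K , w) ⇄₀ (K′ , w′))
  × (∀ v  → R K w v    → ∃[ v′ ] (R K′ w′ v′ × ((K , v) ⇄⟨ k ⟩ (K′ , v′))))
  × (∀ v′ → R K′ w′ v′ → ∃[ v ]  (R K w v    × ((K , v) ⇄⟨ k ⟩ (K′ , v′))))

_[⇄⟨_⟩]_ : {Φ : Set} → KT Φ → ℕ → KT Φ → Set₁
(K , T) [⇄⟨ k ⟩] (K′ , T′) =
    (∀ w  → w ∈ T   → ∃[ w′ ] (w′ ∈ T′ × ((K , w) ⇄⟨ k ⟩ (K′ , w′))))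
  × (∀ w′ → w′ ∈ T′ → ∃[ w ]  (w ∈ T   × ((K , w) ⇄⟨ k ⟩ (K′ , w′))))

module _ {Φ : Set} {ℓ : Level} (𝒦 : Pred (KT Φ) ℓ) where

  ClosedUnderTeamBisimulation : ℕ → Set (lsuc 0ℓ Level.⊔ ℓ)
  ClosedUnderTeamBisimulation k =
    ∀ (M M′ : KT Φ) → M ∈ 𝒦 → M [⇄⟨ k ⟩] M′ → M′ ∈ 𝒦

  -- The index set may be empty.
  ClosedUnderUnions : Set (lsuc 0ℓ Level.⊔ ℓ)
  ClosedUnderUnions =
    ∀ (K : KripkeModel Φ) (I : Set) (T : I → Team K) →
    (∀ i → (K , T i) ∈ 𝒦) → (K , ⋃ I T) ∈ 𝒦

  EmptyTeamProperty : Set (lsuc 0ℓ Level.⊔ ℓ)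
  EmptyTeamProperty = ∀ (K : KripkeModel Φ) → (K , ∅) ∈ 𝒦

  DefinableInML▽ : Set (lsuc 0ℓ Level.⊔ ℓ)
  DefinableInML▽ = ∃[ φ ] (∀ (M : KT Φ) → M ∈ 𝒦 ⇔ (M ⊨ φ))

{-# OPTIONS --safe #-}

-- A formula is invariant under team k-bisimulation for k its modal depth, and
-- the connectives preserve unions; the empty team is the empty union.
-- Conversely, the classes of k-bisimilar points of models over a finite Φ are
-- captured by finitely many ▽-free formulas, which are flat. For a finite set X
-- of them, ⋁ X ∧ ⋀ { ▽ χ ∣ χ ∈ X } defines the teams that are empty or realize
-- exactly the classes in X. A class of models closed under unions and team
-- k-bisimulation and containing the empty teams is defined by the disjunction of
-- these formulas over the sets X realized by one of its members: the splitting
-- disjunction merely forms unions of such teams.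

module Submission where

open import Defs
open import Axiom.ExcludedMiddle using (ExcludedMiddle)
open import Data.Bool.Base using (Bool; true; false; if_then_else_)
open import Data.Empty using (⊥; ⊥-elim)
open import Data.List.Base using (List; []; _∷_; _++_; map; filter; foldr; allFin)
open import Data.List.Membership.Propositional using () renaming (_∈_ to _∈ₗ_)
open import Data.List.Membership.Propositional.Properties
  using (∈-map⁺; ∈-map⁻; ∈-++⁺ˡ; ∈-++⁺ʳ; ∈-++⁻; ∈-filter⁺; ∈-filter⁻; ∈-allFin)
open import Data.List.Relation.Unary.Any using (here; there)
import Data.Nat.Base as ℕ
open ℕ using (ℕ; zero; s≤s)
open import Data.Nat.Properties using (≤-refl; m⊔n≤o⇒m≤o; m⊔n≤o⇒n≤o)
open import Data.Product.Base using (_×_; ∃-syntax; _,_; proj₁; proj₂)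
open import Data.Sum.Base using (_⊎_; inj₁; inj₂; [_,_]′)
open import Function.Base using (id; _∘_)
open import Function.Bundles using (_⇔_; mk⇔; Equivalence; Inverse)
open import Level using (Level; 0ℓ; suc; _⊔_; Lift; lift; lower)
open import Relation.Binary.PropositionalEquality using (refl; subst)
open import Relation.Nullary using (¬_; Dec; yes; no; contradiction)
open import Relation.Nullary.Decidable using (True; toWitness; fromWitness; map′)
open import Relation.Unary using (Pred; _∈_; _⊆_; _≐_; _∪_; ∅; Empty; Satisfiable; ⋃)
open Equivalence using (to; from)

private variable
  Φ : Set

lowerExcludedMiddle : ∀ {a} b → ExcludedMiddle (a ⊔ b) → ExcludedMiddle a
lowerExcludedMiddle b em {P} = map′ lower lift (em {Lift b P})

-- Bisimulation of states and teams, and modal depth.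

⇄₀-preserves-V : (M N : PointedModel Φ) → M ⇄₀ N →
  ∀ p → V (proj₁ M) p (proj₂ M) → V (proj₁ N) p (proj₂ N)
⇄₀-preserves-V M N M⇄N p h =
  lower (to (M⇄N p) (lift λ { refl → h })) refl

⇄₀-reflects-V : (M N : PointedModel Φ) → M ⇄₀ N →
  ∀ p → V (proj₁ N) p (proj₂ N) → V (proj₁ M) p (proj₂ M)
⇄₀-reflects-V M N M⇄N p h =
  lower (from (M⇄N p) (lift λ { refl → h })) refl

⇄⇒⇄₀ : ∀ k (M N : PointedModel Φ) → M ⇄⟨ k ⟩ N → M ⇄₀ N
⇄⇒⇄₀ zero      M N h = h
⇄⇒⇄₀ (ℕ.suc k) M N h = proj₁ h

⇄-refl : ∀ k (M : PointedModel Φ) → M ⇄⟨ k ⟩ M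
⇄-refl zero      M       = λ p → mk⇔ id id
⇄-refl (ℕ.suc k) (K , w) =
    (λ p → mk⇔ id id)
  , (λ v wRv → v , wRv , ⇄-refl k (K , v))
  , (λ v wRv → v , wRv , ⇄-refl k (K , v))

≐⇒[⇄] : ∀ k (K : KripkeModel Φ) {S T : Team K} → S ≐ T → (K , S) [⇄⟨ k ⟩] (K , T)
≐⇒[⇄] k K (S⊆T , T⊆S) =
    (λ w w∈S → w , S⊆T w∈S , ⇄-refl k (K , w))
  , (λ w w∈T → w , T⊆S w∈T , ⇄-refl k (K , w))

-- Moving along `R` spends one level: the forth and back clauses of the states in `T` and `T′` match
-- their successors.
⟦⟧-[⇄] : ∀ k {K K′ : KripkeModel Φ} {T : Team K} {T′ : Team K′} →
  (K , T) [⇄⟨ ℕ.suc k ⟩] (K′ , T′) → (K , K ⟦ T ⟧) [⇄⟨ k ⟩] (K′ , K′ ⟦ T′ ⟧)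
⟦⟧-[⇄] k (forth , back) =
    (λ { v (w , w∈T , wRv) →
      let w′ , w′∈T′ , _ , f , _ = forth w w∈T
          v′ , w′Rv′ , v⇄v′ = f v wRv
      in v′ , (w′ , w′∈T′ , w′Rv′) , v⇄v′ })
  , (λ { v′ (w′ , w′∈T′ , w′Rv′) →
      let w , w∈T , _ , _ , b = back w′ w′∈T′
          v , wRv , v⇄v′ = b v′ w′Rv′
      in v , (w , w∈T , wRv) , v⇄v′ })

-- Only `◇` and `□` move along `R`; `▽` passes to a subteam of the same states and so leaves the
-- depth unchanged.
depth : ML▽ Φ → ℕ
depth (var p)  = 0
depth (¬var p) = 0
depth (φ ∧′ ψ) = depth φ ℕ.⊔ depth ψ
depth (φ ∨′ ψ) = depth φ ℕ.⊔ depth ψ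
depth (◇ φ)    = ℕ.suc (depth φ)
depth (□ φ)    = ℕ.suc (depth φ)
depth (▽ φ)    = depth φ

-- Flat modal formulas and their negations.

-- The flat fragment: modal logic in negation normal form, read at single states.
data ML (Φ : Set) : Set where
  atom ¬atom : Φ → ML Φ
  _⋏_ _⋎_    : ML Φ → ML Φ → ML Φ
  dia box    : ML Φ → ML Φ

infix 3 _⊩_

_⊩_ : PointedModel Φ → ML Φ → Set
(K , w) ⊩ atom p  = V K p w
(K , w) ⊩ ¬atom p = ¬ V K p w
(K , w) ⊩ (φ ⋏ ψ) = ((K , w) ⊩ φ) × ((K , w) ⊩ ψ)
(K , w) ⊩ (φ ⋎ ψ) = ((K , w) ⊩ φ) ⊎ ((K , w) ⊩ ψ)
(K , w) ⊩ dia φ   = ∃[ v ] (R K w v × ((K , v) ⊩ φ))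
(K , w) ⊩ box φ   = ∀ v → R K w v → (K , v) ⊩ φ

⌜_⌝ : ML Φ → ML▽ Φ
⌜ atom p ⌝  = var p
⌜ ¬atom p ⌝ = ¬var p
⌜ φ ⋏ ψ ⌝   = ⌜ φ ⌝ ∧′ ⌜ ψ ⌝
⌜ φ ⋎ ψ ⌝   = ⌜ φ ⌝ ∨′ ⌜ ψ ⌝
⌜ dia φ ⌝   = ◇ ⌜ φ ⌝
⌜ box φ ⌝   = □ ⌜ φ ⌝

-- The witnessing teams for `⋎` and `dia` are the largest possible ones: all states of the team, or
-- all its successors, at which the subformula holds.
flat⁺ : ∀ φ (K : KripkeModel Φ) (T : Team K) →
  (∀ w → w ∈ T → (K , w) ⊩ φ) → (K , T) ⊨ ⌜ φ ⌝
flat⁺ (atom p)  K T h = lift λ {w} → h w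
flat⁺ (¬atom p) K T h = lift λ { w (w∈T , w∈V) → h w w∈T w∈V }
flat⁺ (φ ⋏ ψ)   K T h =
    flat⁺ φ K T (λ w w∈T → proj₁ (h w w∈T))
  , flat⁺ ψ K T (λ w w∈T → proj₂ (h w w∈T))
flat⁺ (φ ⋎ ψ)   K T h =
    (λ w → w ∈ T × ((K , w) ⊩ φ))
  , (λ w → w ∈ T × ((K , w) ⊩ ψ))
  , ( [ proj₁ , proj₁ ]′
    , (λ {w} w∈T → [ (λ x → inj₁ (w∈T , x)) , (λ x → inj₂ (w∈T , x)) ]′ (h w w∈T)))
  , flat⁺ φ K _ (λ _ → proj₂)
  , flat⁺ ψ K _ (λ _ → proj₂)
flat⁺ (dia φ)   K T h =
    (λ v → v ∈ K ⟦ T ⟧ × ((K , v) ⊩ φ))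
  , ( (λ v → proj₁)
    , (λ w w∈T → let v , wRv , v⊩φ = h w w∈T in v , ((w , w∈T , wRv) , v⊩φ) , wRv))
  , flat⁺ φ K _ (λ _ → proj₂)
flat⁺ (box φ)   K T h =
  flat⁺ φ K _ (λ { v (w , w∈T , wRv) → h w w∈T v wRv })

flat⁻ : ∀ φ (K : KripkeModel Φ) (T : Team K) →
  (K , T) ⊨ ⌜ φ ⌝ → ∀ w → w ∈ T → (K , w) ⊩ φ
flat⁻ (atom p)  K T h         w w∈T = lower h w∈T
flat⁻ (¬atom p) K T h         w w∈T = λ w∈V → lower h w (w∈T , w∈V)
flat⁻ (φ ⋏ ψ)   K T (hφ , hψ) w w∈T = flat⁻ φ K T hφ w w∈T , flat⁻ ψ K T hψ w w∈T
flat⁻ (φ ⋎ ψ)   K T (T₁ , T₂ , (_ , T⊆) , hφ , hψ) w w∈T with T⊆ w∈T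
... | inj₁ w∈T₁ = inj₁ (flat⁻ φ K T₁ hφ w w∈T₁)
... | inj₂ w∈T₂ = inj₂ (flat⁻ ψ K T₂ hψ w w∈T₂)
flat⁻ (dia φ)   K T (S , (_ , T→S) , hφ) w w∈T =
  let v , v∈S , wRv = T→S w w∈T in v , wRv , flat⁻ φ K S hφ v v∈S
flat⁻ (box φ)   K T h w w∈T = λ v wRv → flat⁻ φ K _ h v (w , w∈T , wRv)

-- Negation is pushed through the duals down to the atoms, since only symbols can be negated in the
-- syntax.
∼_ : ML Φ → ML Φ
∼ atom p  = ¬atom p
∼ ¬atom p = atom p
∼ (φ ⋏ ψ) = (∼ φ) ⋎ (∼ ψ)
∼ (φ ⋎ ψ) = (∼ φ) ⋏ (∼ ψ)
∼ dia φ   = box (∼ φ)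
∼ box φ   = dia (∼ φ)

-- This half is constructive; its converse `∼-complete` takes excluded middle.
∼-sound : ∀ φ (M : PointedModel Φ) → M ⊩ ∼ φ → ¬ (M ⊩ φ)
∼-sound (atom p)  M h             = h
∼-sound (¬atom p) M h             = λ k → k h
∼-sound (φ ⋏ ψ)   M (inj₁ h)      = ∼-sound φ M h ∘ proj₁
∼-sound (φ ⋏ ψ)   M (inj₂ h)      = ∼-sound ψ M h ∘ proj₂
∼-sound (φ ⋎ ψ)   M (h₁ , h₂)     = [ ∼-sound φ M h₁ , ∼-sound ψ M h₂ ]′
∼-sound (dia φ)   (K , w) h       = λ { (v , wRv , x) → ∼-sound φ (K , v) (h v wRv) x }
∼-sound (box φ)   (K , w) (v , wRv , x) = λ h → ∼-sound φ (K , v) x (h v wRv)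

-- Hintikka formulas.

-- The syntax has no constants, so both are built from a symbol; this is where nonemptiness of `Φ`
-- enters.
⊥ᴹ ⊤ᴹ : Φ → ML Φ
⊥ᴹ p = atom p ⋏ ¬atom p
⊤ᴹ p = atom p ⋎ ¬atom p

⋁ : Φ → List (ML Φ) → ML Φ
⋁ p = foldr _⋎_ (⊥ᴹ p)

⋁⁺ : ∀ p {φ} {φs : List (ML Φ)} (M : PointedModel Φ) → φ ∈ₗ φs → M ⊩ φ → M ⊩ ⋁ p φs
⋁⁺ p M (here refl)  h = inj₁ h
⋁⁺ p M (there φ∈φs) h = inj₂ (⋁⁺ p M φ∈φs h)

⋁⁻ : ∀ p (φs : List (ML Φ)) (M : PointedModel Φ) → M ⊩ ⋁ p φs → ∃[ φ ] (φ ∈ₗ φs × (M ⊩ φ))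
⋁⁻ p []       M (h , ¬h) = contradiction h ¬h
⋁⁻ p (φ ∷ φs) M (inj₁ h) = φ , here refl , h
⋁⁻ p (φ ∷ φs) M (inj₂ h) = let ψ , ψ∈φs , x = ⋁⁻ p φs M h in ψ , there ψ∈φs , x

-- The constituents over a list: conjunctions that take each formula either as it stands or negated.
completions : Φ → List (ML Φ) → List (ML Φ)
completions p []       = ⊤ᴹ p ∷ []
completions p (φ ∷ φs) =
  map (φ ⋏_) (completions p φs) ++ map ((∼ φ) ⋏_) (completions p φs)

-- The constituent contains `φ` or `∼ φ`. In the first case it yields `φ` at `N`; in the second it
-- contradicts `φ` at `M`.
completions-agree : ∀ p (φs : List (ML Φ)) {χ} → χ ∈ₗ completions p φs →
  ∀ M N → M ⊩ χ → N ⊩ χ → ∀ {φ} → φ ∈ₗ φs → M ⊩ φ → N ⊩ φ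
completions-agree p (ψ ∷ φs) χ∈ M N hM hN φ∈ with ∈-++⁻ (map (ψ ⋏_) (completions p φs)) χ∈
completions-agree p (ψ ∷ φs) χ∈ M N hM hN φ∈ | inj₁ χ∈₁ with ∈-map⁻ (ψ ⋏_) χ∈₁ | φ∈
... | _ , _   , refl | here refl = λ _ → proj₁ hN
... | _ , χ′∈ , refl | there φ∈′ = completions-agree p φs χ′∈ M N (proj₂ hM) (proj₂ hN) φ∈′
completions-agree p (ψ ∷ φs) χ∈ M N hM hN φ∈ | inj₂ χ∈₂ with ∈-map⁻ ((∼ ψ) ⋏_) χ∈₂ | φ∈
... | _ , _   , refl | here refl = λ h → contradiction h (∼-sound ψ M (proj₁ hM))
... | _ , χ′∈ , refl | there φ∈′ = completions-agree p φs χ′∈ M N (proj₂ hM) (proj₂ hN) φ∈′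

module _ (props : List Φ) (p₀ : Φ) where

  mutual
    -- A constituent decides every `dia ξ` with `ξ` a type one level below. Negated, this is
    -- `box (∼ ξ)`, so the constituent fixes exactly which types occur among the successors.
    distinguishing : ℕ → List (ML Φ)
    distinguishing zero      = map atom props
    distinguishing (ℕ.suc k) = map atom props ++ map dia (hintikka k)

    hintikka : ℕ → List (ML Φ)
    hintikka k = completions p₀ (distinguishing k)

  atom∈distinguishing : ∀ k {p} → p ∈ₗ props → atom p ∈ₗ distinguishing k
  atom∈distinguishing zero      = ∈-map⁺ atom
  atom∈distinguishing (ℕ.suc k) = ∈-++⁺ˡ ∘ ∈-map⁺ atom

  hintikka-transfer : ∀ k {χ} → χ ∈ₗ hintikka k →
    ∀ M N → M ⊩ χ → N ⊩ χ → ∀ {φ} → φ ∈ₗ distinguishing k → M ⊩ φ → N ⊩ φ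
  hintikka-transfer k = completions-agree p₀ (distinguishing k)

-- Formulas for teams realizing a given set of types.

Realizes : KT Φ → List (ML Φ) → Set
Realizes (K , T) X =
    (∀ w → w ∈ T → ∃[ χ ] (χ ∈ₗ X × ((K , w) ⊩ χ)))
  × (∀ {χ} → χ ∈ₗ X → ∃[ w ] (w ∈ T × ((K , w) ⊩ χ)))

module _ (p₀ : Φ) where

  witnessing : ML▽ Φ → List (ML Φ) → ML▽ Φ
  witnessing = foldr (λ χ ψ → (▽ ⌜ χ ⌝) ∧′ ψ)

  realizing : List (ML Φ) → ML▽ Φ
  realizing X = witnessing ⌜ ⋁ p₀ X ⌝ X

  ⊨-witnessing : ∀ K (T : Team K) ψ X → (K , T) ⊨ ψ →
    (∀ {χ} → χ ∈ₗ X → ∃[ w ] (w ∈ T × ((K , w) ⊩ χ))) → (K , T) ⊨ witnessing ψ X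
  ⊨-witnessing K T ψ []      hψ h = hψ
  ⊨-witnessing K T ψ (χ ∷ X) hψ h =
      inj₂ ( (λ w → w ∈ T × ((K , w) ⊩ χ)) , proj₁ , h (here refl)
           , flat⁺ χ K _ (λ _ → proj₂))
    , ⊨-witnessing K T ψ X hψ (h ∘ there)

  -- Each `▽` holds vacuously in an empty team, hence the assumption `Satisfiable T`. Otherwise it
  -- supplies a nonempty subteam, and by flatness any of its states is a witness.
  ⊨-witnessing⁻ : ∀ K (T : Team K) ψ X → (K , T) ⊨ witnessing ψ X → Satisfiable T →
    ((K , T) ⊨ ψ) × (∀ {χ} → χ ∈ₗ X → ∃[ w ] (w ∈ T × ((K , w) ⊩ χ)))
  ⊨-witnessing⁻ K T ψ []      h       _         = h , λ ()
  ⊨-witnessing⁻ K T ψ (χ ∷ X) (inj₁ T-empty , _) (w , w∈T) = contradiction w∈T (T-empty w)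
  ⊨-witnessing⁻ K T ψ (χ ∷ X) (inj₂ (S , S⊆T , (w , w∈S) , hS) , h) T-sat =
    let hψ , hX = ⊨-witnessing⁻ K T ψ X h T-sat
    in hψ , λ { (here refl) → w , S⊆T w∈S , flat⁻ χ K S hS w w∈S
              ; (there χ∈X) → hX χ∈X }

  Realizes⇒⊨ : ∀ (M : KT Φ) X → Realizes M X → M ⊨ realizing X
  Realizes⇒⊨ (K , T) X (cover , hit) =
    ⊨-witnessing K T _ X
      (flat⁺ (⋁ p₀ X) K T λ w w∈T →
        let χ , χ∈X , x = cover w w∈T in ⋁⁺ p₀ (K , w) χ∈X x)
      hit

  ⊨⇒Realizes : ∀ K (T : Team K) X → (K , T) ⊨ realizing X → Satisfiable T →
    Realizes (K , T) X
  ⊨⇒Realizes K T X h T-sat =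
    let h⋁ , hit = ⊨-witnessing⁻ K T _ X h T-sat
    in (λ w w∈T → ⋁⁻ p₀ X (K , w) (flat⁻ (⋁ p₀ X) K T h⋁ w w∈T)) , hit

  disjunction : List (List (ML Φ)) → ML▽ Φ
  -- The base formula holds exactly in the empty teams, so it is neutral for splitting.
  disjunction = foldr (λ X ψ → realizing X ∨′ ψ) ⌜ ⊥ᴹ p₀ ⌝

sublists : ∀ {a} {A : Set a} → List A → List (List A)
sublists []       = [] ∷ []
sublists (x ∷ xs) = map (x ∷_) (sublists xs) ++ sublists xs

filter∈sublists : ∀ {a q} {A : Set a} {Q : Pred A q} (Q? : ∀ x → Dec (Q x)) →
  ∀ xs → filter Q? xs ∈ₗ sublists xs
filter∈sublists Q? []       = here refl
filter∈sublists Q? (x ∷ xs) with Q? x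
... | yes _ = ∈-++⁺ˡ (∈-map⁺ (x ∷_) (filter∈sublists Q? xs))
... | no  _ = ∈-++⁺ʳ (map (x ∷_) (sublists xs)) (filter∈sublists Q? xs)

-- Invariance under bisimulation and closure under unions.

module _ (em₁ : ExcludedMiddle (suc 0ℓ)) where

  em₀ : ExcludedMiddle 0ℓ
  em₀ = lowerExcludedMiddle (suc 0ℓ) em₁

  -- Bisimilarity lives in Set₁ while teams are predicates in Set; excluded middle
  -- provides the resizing that turns one into the other.
  bisimilarPart : ℕ → KT Φ → (M : KT Φ) → Team (proj₁ M)
  bisimilarPart k (K , S) (K′ , T′) w′ =
    w′ ∈ T′ × True (em₁ {∃[ w ] (w ∈ S × ((K , w) ⇄⟨ k ⟩ (K′ , w′)))})

  -- Forth is inherited from the larger team `T`; back is built into the definition of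
  -- `bisimilarPart`.
  bisimilarPart-[⇄] : ∀ k {K K′ : KripkeModel Φ} {S T : Team K} {T′ : Team K′} →
    (K , T) [⇄⟨ k ⟩] (K′ , T′) → S ⊆ T →
    (K , S) [⇄⟨ k ⟩] (K′ , bisimilarPart k (K , S) (K′ , T′))
  bisimilarPart-[⇄] k (forth , _) S⊆T =
      (λ w w∈S → let w′ , w′∈T′ , w⇄w′ = forth w (S⊆T w∈S)
                 in w′ , (w′∈T′ , fromWitness (w , w∈S , w⇄w′)) , w⇄w′)
    , (λ { w′ (_ , t) → toWitness t })

  -- Stated for every `k` above the depth, so that both subformulas of a binary connective can be
  -- treated at the same `k`.
  ⊨-invariant : ∀ (φ : ML▽ Φ) k → depth φ ℕ.≤ k → (M M′ : KT Φ) →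
    M [⇄⟨ k ⟩] M′ → M ⊨ φ → M′ ⊨ φ
  ⊨-invariant (var p) k d (K , T) (K′ , T′) (_ , back) h = lift λ {w′} w′∈T′ →
    let w , w∈T , w⇄w′ = back w′ w′∈T′
    in ⇄₀-preserves-V (K , w) (K′ , w′) (⇄⇒⇄₀ k _ _ w⇄w′) p (lower h w∈T)
  ⊨-invariant (¬var p) k d (K , T) (K′ , T′) (_ , back) h = lift λ { w′ (w′∈T′ , w′∈V) →
    let w , w∈T , w⇄w′ = back w′ w′∈T′
    in lower h w (w∈T , ⇄₀-reflects-V (K , w) (K′ , w′) (⇄⇒⇄₀ k _ _ w⇄w′) p w′∈V) }
  ⊨-invariant (φ ∧′ ψ) k d M M′ M⇄M′ (hφ , hψ) =
      ⊨-invariant φ k (m⊔n≤o⇒m≤o _ _ d) M M′ M⇄M′ hφ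
    , ⊨-invariant ψ k (m⊔n≤o⇒n≤o _ _ d) M M′ M⇄M′ hψ
  ⊨-invariant (φ ∨′ ψ) k d (K , T) (K′ , T′) M⇄M′ (T₁ , T₂ , (⊆T , T⊆) , hφ , hψ) =
      bisimilarPart k (K , T₁) (K′ , T′)
    , bisimilarPart k (K , T₂) (K′ , T′)
    , ([ proj₁ , proj₁ ]′ , split)
    , ⊨-invariant φ k (m⊔n≤o⇒m≤o _ _ d) _ _ (bisimilarPart-[⇄] k M⇄M′ (⊆T ∘ inj₁)) hφ
    , ⊨-invariant ψ k (m⊔n≤o⇒n≤o _ _ d) _ _ (bisimilarPart-[⇄] k M⇄M′ (⊆T ∘ inj₂)) hψ
    where
    split : T′ ⊆ bisimilarPart k (K , T₁) (K′ , T′) ∪ bisimilarPart k (K , T₂) (K′ , T′)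
    split {w′} w′∈T′ with proj₂ M⇄M′ w′ w′∈T′
    ... | w , w∈T , w⇄w′ with T⊆ w∈T
    ...   | inj₁ w∈T₁ = inj₁ (w′∈T′ , fromWitness (w , w∈T₁ , w⇄w′))
    ...   | inj₂ w∈T₂ = inj₂ (w′∈T′ , fromWitness (w , w∈T₂ , w⇄w′))
  ⊨-invariant (◇ φ) (ℕ.suc k) (s≤s d) (K , T) (K′ , T′) M⇄M′ (S , (S→T , T→S) , hφ) =
      -- All successors of `T′` bisimilar to a state in `S`. Every `w′` in `T′` sees one: its
      -- partner `w` sees some `v` in `S`, which forth transfers to a successor of `w′`.
      bisimilarPart k (K , S) (K′ , K′ ⟦ T′ ⟧)
    , ((λ v′ → proj₁) , λ w′ w′∈T′ →
        let w , w∈T , _ , f , _ = proj₂ M⇄M′ w′ w′∈T′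
            v , v∈S , wRv = T→S w w∈T
            v′ , w′Rv′ , v⇄v′ = f v wRv
        in v′ , ((w′ , w′∈T′ , w′Rv′) , fromWitness (v , v∈S , v⇄v′)) , w′Rv′)
    , ⊨-invariant φ k d _ _ (bisimilarPart-[⇄] k (⟦⟧-[⇄] k M⇄M′) (λ {v} → S→T v)) hφ
  ⊨-invariant (□ φ) (ℕ.suc k) (s≤s d) M M′ M⇄M′ h =
    ⊨-invariant φ k d _ _ (⟦⟧-[⇄] k M⇄M′) h
  ⊨-invariant (▽ φ) k d (K , T) (K′ , T′) (_ , back) (inj₁ T-empty) =
    inj₁ λ w′ w′∈T′ → let w , w∈T , _ = back w′ w′∈T′ in T-empty w w∈T
  ⊨-invariant (▽ φ) k d (K , T) (K′ , T′) M⇄M′ (inj₂ (S , S⊆T , (w , w∈S) , hφ)) =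
    let S⇄S′ = bisimilarPart-[⇄] k M⇄M′ S⊆T
        w′ , w′∈S′ , _ = proj₁ S⇄S′ w w∈S
    in inj₂ (_ , proj₁ , (w′ , w′∈S′) , ⊨-invariant φ k d _ _ S⇄S′ hφ)

  -- Mutual inclusion makes the identity a team bisimulation, so this is a case of invariance.
  ⊨-resp-≐ : ∀ (φ : ML▽ Φ) (K : KripkeModel Φ) {S T : Team K} →
    S ≐ T → (K , S) ⊨ φ → (K , T) ⊨ φ
  ⊨-resp-≐ φ K S≐T = ⊨-invariant φ (depth φ) ≤-refl _ _ (≐⇒[⇄] (depth φ) K S≐T)

  -- The witnessing teams for `∨′` and `◇` are the unions of those given for each `i`.
  ⊨-⋃ : ∀ (φ : ML▽ Φ) (K : KripkeModel Φ) (I : Set) (T : I → Team K) →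
    (∀ i → (K , T i) ⊨ φ) → (K , ⋃ I T) ⊨ φ
  ⊨-⋃ (var p)  K I T h = lift λ { (i , w∈T) → lower (h i) w∈T }
  ⊨-⋃ (¬var p) K I T h = lift λ { w ((i , w∈T) , w∈V) → lower (h i) w (w∈T , w∈V) }
  ⊨-⋃ (φ ∧′ ψ) K I T h = ⊨-⋃ φ K I T (proj₁ ∘ h) , ⊨-⋃ ψ K I T (proj₂ ∘ h)
  ⊨-⋃ (φ ∨′ ψ) K I T h =
      ⋃ I (λ i → proj₁ (h i))
    , ⋃ I (λ i → proj₁ (proj₂ (h i)))
    , ( (λ { (inj₁ (i , x)) → i , proj₁ (parts i) (inj₁ x)
           ; (inj₂ (i , x)) → i , proj₁ (parts i) (inj₂ x) })
      , (λ { (i , x) → [ (λ y → inj₁ (i , y)) , (λ y → inj₂ (i , y)) ]′ (proj₂ (parts i) x) }))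
    , ⊨-⋃ φ K I _ (λ i → proj₁ (proj₂ (proj₂ (proj₂ (h i)))))
    , ⊨-⋃ ψ K I _ (λ i → proj₂ (proj₂ (proj₂ (proj₂ (h i)))))
    where
    parts : ∀ i → proj₁ (h i) ∪ proj₁ (proj₂ (h i)) ≐ T i
    parts i = proj₁ (proj₂ (proj₂ (h i)))
  ⊨-⋃ (◇ φ) K I T h =
      ⋃ I (λ i → proj₁ (h i))
    , ( (λ { v (i , v∈S) → let w , w∈T , wRv = proj₁ (proj₁ (proj₂ (h i))) v v∈S
                           in w , (i , w∈T) , wRv })
      , (λ { w (i , w∈T) → let v , v∈S , wRv = proj₂ (proj₁ (proj₂ (h i))) w w∈T
                           in v , (i , v∈S) , wRv }))
    , ⊨-⋃ φ K I _ (λ i → proj₂ (proj₂ (h i)))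
  ⊨-⋃ (□ φ) K I T h =
    -- Taking successors commutes with unions up to `≐`.
    ⊨-resp-≐ φ K
      ( (λ { (i , w , w∈T , wRv) → w , (i , w∈T) , wRv })
      , (λ { (w , (i , w∈T) , wRv) → i , w , w∈T , wRv }))
      (⊨-⋃ φ K I _ h)
  -- If the union is inhabited, a single nonempty `T i` already provides the subteam.
  ⊨-⋃ (▽ φ) K I T h with em₀ {Satisfiable (⋃ I T)}
  ... | no  ¬sat = inj₁ λ w w∈T → ¬sat (w , w∈T)
  ... | yes (w , i , w∈T) with h i
  ...   | inj₁ Ti-empty           = contradiction w∈T (Ti-empty w)
  ...   | inj₂ (S , S⊆T , ne , x) = inj₂ (S , (λ w∈S → i , S⊆T w∈S) , ne , x)

  ⊨-empty : ∀ (φ : ML▽ Φ) (K : KripkeModel Φ) {T : Team K} → Empty T → (K , T) ⊨ φ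
  ⊨-empty φ K T-empty =
    ⊨-resp-≐ φ K ((λ { (() , _) }) , λ {w} w∈T → ⊥-elim (T-empty w w∈T))
      (⊨-⋃ φ K ⊥ (λ ()) (λ ()))

  -- Hintikka formulas determine bisimilarity classes.

  ∼-complete : ∀ φ (M : PointedModel Φ) → ¬ (M ⊩ φ) → M ⊩ ∼ φ
  ∼-complete (atom p)  M h = h
  ∼-complete (¬atom p) (K , w) h with em₀ {V K p w}
  ... | yes x = x
  ... | no ¬x = contradiction ¬x h
  ∼-complete (φ ⋏ ψ) M h with em₀ {M ⊩ φ}
  ... | yes x = inj₂ (∼-complete ψ M λ y → h (x , y))
  ... | no ¬x = inj₁ (∼-complete φ M ¬x)
  ∼-complete (φ ⋎ ψ) M h = ∼-complete φ M (h ∘ inj₁) , ∼-complete ψ M (h ∘ inj₂)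
  ∼-complete (dia φ) (K , w) h =
    λ v wRv → ∼-complete φ (K , v) λ x → h (v , wRv , x)
  ∼-complete (box φ) (K , w) h with em₀ {∃[ v ] (R K w v × ¬ ((K , v) ⊩ φ))}
  ... | yes (v , wRv , ¬x) = v , wRv , ∼-complete φ (K , v) ¬x
  ... | no  none = contradiction all h
    where
    all : ∀ v → R K w v → (K , v) ⊩ φ
    all v wRv with em₀ {(K , v) ⊩ φ}
    ... | yes x = x
    ... | no ¬x = contradiction (v , wRv , ¬x) none

  completions-exhaustive : ∀ p (φs : List (ML Φ)) (M : PointedModel Φ) →
    ∃[ χ ] (χ ∈ₗ completions p φs × (M ⊩ χ))
  completions-exhaustive p [] (K , w) with em₀ {V K p w}
  ... | yes x = ⊤ᴹ p , here refl , inj₁ x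
  ... | no ¬x = ⊤ᴹ p , here refl , inj₂ ¬x
  completions-exhaustive p (φ ∷ φs) M with em₀ {M ⊩ φ} | completions-exhaustive p φs M
  ... | yes x | χ , χ∈ , y = φ ⋏ χ , ∈-++⁺ˡ (∈-map⁺ (φ ⋏_) χ∈) , x , y
  ... | no ¬x | χ , χ∈ , y =
    (∼ φ) ⋏ χ , ∈-++⁺ʳ _ (∈-map⁺ ((∼ φ) ⋏_) χ∈) , ∼-complete φ M ¬x , y

  module _ (props : List Φ) (p₀ : Φ) (all∈props : ∀ p → p ∈ₗ props) where

    hintikka-exhaustive : ∀ k M → ∃[ χ ] (χ ∈ₗ hintikka props p₀ k × (M ⊩ χ))
    hintikka-exhaustive k = completions-exhaustive p₀ (distinguishing props p₀ k)

    hintikka-⇄₀ : ∀ k {χ} → χ ∈ₗ hintikka props p₀ k → ∀ M N → M ⊩ χ → N ⊩ χ → M ⇄₀ N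
    hintikka-⇄₀ k χ∈ M N hM hN p = mk⇔
      (λ x → lift λ { refl → hintikka-transfer props p₀ k χ∈ M N hM hN p∈ (lower x refl) })
      (λ x → lift λ { refl → hintikka-transfer props p₀ k χ∈ N M hN hM p∈ (lower x refl) })
      where
      p∈ : atom p ∈ₗ distinguishing props p₀ k
      p∈ = atom∈distinguishing props p₀ k (all∈props p)

    -- A successor `v` has some type `ξ` of level `k`. Since `dia ξ` is among the distinguishing
    -- formulas, it transfers and gives a successor of the same type on the other side; induction
    -- applies to this pair.
    hintikka-⇄ : ∀ k {χ} → χ ∈ₗ hintikka props p₀ k → ∀ M N → M ⊩ χ → N ⊩ χ → M ⇄⟨ k ⟩ N
    hintikka-⇄ zero      χ∈ M N hM hN = hintikka-⇄₀ zero χ∈ M N hM hN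
    hintikka-⇄ (ℕ.suc k) {χ} χ∈ (K , w) (K′ , w′) hw hw′ =
        hintikka-⇄₀ (ℕ.suc k) χ∈ _ _ hw hw′
      , (λ v wRv →
          let ξ , ξ∈ , hv = hintikka-exhaustive k (K , v)
              v′ , w′Rv′ , hv′ = hintikka-transfer props p₀ (ℕ.suc k) χ∈ (K , w) (K′ , w′) hw hw′
                                   (dia∈ ξ∈) (v , wRv , hv)
          in v′ , w′Rv′ , hintikka-⇄ k ξ∈ _ _ hv hv′)
      , (λ v′ w′Rv′ →
          let ξ , ξ∈ , hv′ = hintikka-exhaustive k (K′ , v′)
              v , wRv , hv = hintikka-transfer props p₀ (ℕ.suc k) χ∈ (K′ , w′) (K , w) hw′ hw
                               (dia∈ ξ∈) (v′ , w′Rv′ , hv′)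
          in v , wRv , hintikka-⇄ k ξ∈ _ _ hv hv′)
      where
      dia∈ : ∀ {ξ} → ξ ∈ₗ hintikka props p₀ k → dia ξ ∈ₗ distinguishing props p₀ (ℕ.suc k)
      dia∈ = ∈-++⁺ʳ (map atom props) ∘ ∈-map⁺ dia

  -- The whole team goes to the chosen disjunct and the empty team to every other one.
  ⊨-disjunction : ∀ p₀ (M : KT Φ) {X Xs} → X ∈ₗ Xs → M ⊨ realizing p₀ X →
    M ⊨ disjunction p₀ Xs
  ⊨-disjunction p₀ (K , T) {X} {_ ∷ Xs} (here refl) h =
    T , ∅ , ([ id , (λ ()) ]′ , inj₁) , h , ⊨-empty (disjunction p₀ Xs) K (λ _ ())
  ⊨-disjunction p₀ (K , T) {X} {Y ∷ _} (there X∈) h =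
      ∅ , T , ([ (λ ()) , id ]′ , inj₂)
    , ⊨-empty (realizing p₀ Y) K (λ _ ()) , ⊨-disjunction p₀ (K , T) X∈ h

-- The two directions of the characterization.

module _ {ℓ} (em : ExcludedMiddle (suc 0ℓ ⊔ ℓ)) (𝒦 : Pred (KT Φ) ℓ) where

  private
    em₁ : ExcludedMiddle (suc 0ℓ)
    em₁ = lowerExcludedMiddle ℓ em

  definable⇒closed : DefinableInML▽ 𝒦 →
    ClosedUnderUnions 𝒦 × (∃[ k ] ClosedUnderTeamBisimulation 𝒦 k) × EmptyTeamProperty 𝒦
  definable⇒closed (φ , defines) =
      (λ K I T h → from (defines _) (⊨-⋃ em₁ φ K I T λ i → to (defines _) (h i)))
    , (depth φ , λ M M′ M∈𝒦 M⇄M′ →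
        from (defines M′) (⊨-invariant em₁ φ (depth φ) ≤-refl M M′ M⇄M′ (to (defines M) M∈𝒦)))
    , (λ K → from (defines _) (⊨-empty em₁ φ K (λ _ ())))

  module _ (props : List Φ) (p₀ : Φ) (all∈props : ∀ p → p ∈ₗ props)
           (∪-closed : ClosedUnderUnions 𝒦) (k : ℕ)
           (⇄-closed : ClosedUnderTeamBisimulation 𝒦 k) (∅-closed : EmptyTeamProperty 𝒦) where

    private
      types : List (ML Φ)
      types = hintikka props p₀ k

    RealizedIn𝒦 : List (ML Φ) → Set (suc 0ℓ ⊔ ℓ)
    RealizedIn𝒦 X = (∀ {χ} → χ ∈ₗ X → χ ∈ₗ types) × (∃[ M ] (M ∈ 𝒦 × Realizes M X))

    same-types⇒[⇄] : ∀ {X} → (∀ {χ} → χ ∈ₗ X → χ ∈ₗ types) →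
      ∀ M N → Realizes M X → Realizes N X → M [⇄⟨ k ⟩] N
    same-types⇒[⇄] X⊆ M N (coverM , hitM) (coverN , hitN) =
        (λ w w∈ → let χ , χ∈X , hw = coverM w w∈
                      v , v∈ , hv = hitN χ∈X
                  in v , v∈ , hintikka-⇄ em₁ props p₀ all∈props k (X⊆ χ∈X) _ _ hw hv)
      , (λ v v∈ → let χ , χ∈X , hv = coverN v v∈
                      w , w∈ , hw = hitM χ∈X
                  in w , w∈ , hintikka-⇄ em₁ props p₀ all∈props k (X⊆ χ∈X) _ _ hw hv)

    𝒦-resp-≐ : ∀ K {S T : Team K} → S ≐ T → (K , S) ∈ 𝒦 → (K , T) ∈ 𝒦
    𝒦-resp-≐ K S≐T S∈𝒦 = ⇄-closed _ _ S∈𝒦 (≐⇒[⇄] k K S≐T)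

    𝒦-empty : ∀ K {T : Team K} → Empty T → (K , T) ∈ 𝒦
    𝒦-empty K T-empty =
      𝒦-resp-≐ K ((λ ()) , λ {w} w∈T → ⊥-elim (T-empty w w∈T)) (∅-closed K)

    -- A nonempty team satisfying `realizing p₀ X` has the same types as the member `N` of `𝒦` that
    -- realizes `X`, hence is team bisimilar to it. Empty teams lie in `𝒦` anyway.
    realizing⇒𝒦 : ∀ {X} → RealizedIn𝒦 X → ∀ M → M ⊨ realizing p₀ X → M ∈ 𝒦
    realizing⇒𝒦 {X} (X⊆ , N , N∈𝒦 , rN) (K , T) h with em₀ em₁ {Satisfiable T}
    ... | no ¬sat = 𝒦-empty K λ w w∈T → ¬sat (w , w∈T)
    ... | yes sat =
      ⇄-closed N (K , T) N∈𝒦 (same-types⇒[⇄] X⊆ N (K , T) rN (⊨⇒Realizes p₀ K T X h sat))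

    disjunction⇒𝒦 : ∀ Xs → (∀ {X} → X ∈ₗ Xs → RealizedIn𝒦 X) →
      ∀ M → M ⊨ disjunction p₀ Xs → M ∈ 𝒦
    disjunction⇒𝒦 [] _ (K , T) (T⊆V , T∩V-empty) =
      𝒦-empty K λ w w∈T → lower T∩V-empty w (w∈T , lower T⊆V w∈T)
    disjunction⇒𝒦 (X ∷ Xs) realized (K , T) (T₁ , T₂ , (⊆T , T⊆) , h₁ , h₂) =
      𝒦-resp-≐ K
        ( (λ { (true , x) → ⊆T (inj₁ x) ; (false , x) → ⊆T (inj₂ x) })
        , (λ w∈T → [ true ,_ , false ,_ ]′ (T⊆ w∈T)))
        -- The two halves of the split are a family indexed by `Bool`, whose union is `T` up to `≐`.
        (∪-closed K Bool (λ b → if b then T₁ else T₂)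
          λ { true  → realizing⇒𝒦 (realized (here refl)) (K , T₁) h₁
            ; false → disjunction⇒𝒦 Xs (realized ∘ there) (K , T₂) h₂ })

    closed⇒definable : DefinableInML▽ 𝒦
    closed⇒definable = disjunction p₀ Xs , λ M → mk⇔ (complete M)
      (disjunction⇒𝒦 Xs (λ X∈ → proj₂ (∈-filter⁻ realized? {xs = sublists types} X∈)) M)
      where
      realized? : ∀ X → Dec (RealizedIn𝒦 X)
      -- The property quantifies over all of `KT Φ` and mentions `𝒦`, so excluded middle is used at
      -- level `suc 0ℓ ⊔ ℓ`.
      realized? X = em

      Xs : List (List (ML Φ))
      Xs = filter realized? (sublists types)

      complete : ∀ M → M ∈ 𝒦 → M ⊨ disjunction p₀ Xs
      -- The disjunct is given by the types occurring in `T`; the team itself witnesses that this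
      -- set is realized in `𝒦`.
      complete (K , T) M∈𝒦 = ⊨-disjunction em₁ p₀ (K , T)
          (∈-filter⁺ realized? (filter∈sublists occurs? types)
            ((λ χ∈X → proj₁ (∈-filter⁻ occurs? {xs = types} χ∈X)) , (K , T) , M∈𝒦 , M-realizes-X))
          (Realizes⇒⊨ p₀ (K , T) X M-realizes-X)
        where
        occurs? : ∀ χ → Dec (∃[ w ] (w ∈ T × ((K , w) ⊩ χ)))
        occurs? χ = em₀ em₁

        X : List (ML Φ)
        X = filter occurs? types

        M-realizes-X : Realizes (K , T) X
        M-realizes-X =
            (λ w w∈T → let χ , χ∈ , x = hintikka-exhaustive em₁ props p₀ all∈props k (K , w)
                       in χ , ∈-filter⁺ occurs? χ∈ (w , w∈T , x) , x)
          , (λ χ∈X → proj₂ (∈-filter⁻ occurs? {xs = types} χ∈X))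

Finite⇒listable : Finite Φ → ∃[ props ] (∀ (p : Φ) → p ∈ₗ props)
Finite⇒listable (n , Φ↔Fin) = map (Inverse.from Φ↔Fin) (allFin n) , λ p →
  subst (_∈ₗ map (Inverse.from Φ↔Fin) (allFin n)) (Inverse.strictlyInverseʳ Φ↔Fin p)
    (∈-map⁺ (Inverse.from Φ↔Fin) (∈-allFin (Inverse.to Φ↔Fin p)))

theorem4p8 : ∀ {ℓ : Level} → ExcludedMiddle (suc 0ℓ ⊔ ℓ) →
    (Φ : Set) → Finite Φ → Φ →
    (𝒦 : Pred (KT Φ) ℓ) →
    DefinableInML▽ 𝒦 ⇔
    (ClosedUnderUnions 𝒦 × (∃[ k ] ClosedUnderTeamBisimulation 𝒦 k) × EmptyTeamProperty 𝒦)
theorem4p8 em Φ Φ-finite p₀ 𝒦 = mk⇔ (definable⇒closed em 𝒦)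
  λ { (∪-closed , (k , ⇄-closed) , ∅-closed) →
      let props , all∈props = Finite⇒listable Φ-finite
      in closed⇒definable em 𝒦 props p₀ all∈props ∪-closed k ⇄-closed ∅-closed }
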